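{- Let $f:\mathbb{N}\to\mathbb{N}$ be a function. The following conditions are equivalent. (i) Every lattice of regular subsets of $\mathbb{N}$ closed under decrement is closed under $f^{ -1}$. (ii) For every finite subset $L$ of $\mathbb{N}$, the lattice $\mathcal{L}(L)$ is closed under $f^{ -1}$. (iii) For every arithmetic progression $L=q+r\mathbb{N}$, with $q,r\in\mathbb{N}$ and $r>0$, the lattice $\mathcal{L}(L)$ is closed under $f^{ -1}$. (iv) The map $f$ is non decreasing and satisfies $f(a)\geq a$ and $f(a)-f(b)\equiv 0\pmod{(a-b)}$ for all $a,b\in\mathbb{N}$.
   Context: $\mathbb{N}=\{0,1,2,\ldots\}$. A function $f:\mathbb{N}\to\mathbb{N}$ is non decreasing if $a\leq b$ implies $f(a)\leq f(b)$. A lattice over a set $X$ is any non empty family of subsets of $X$ closed under (binary) union and intersection. For $L\subseteq\mathbb{N}$ and $i\in\mathbb{N}$, the $i$-decrement of $L$ is $L-i=\{x\in\mathbb{N}\mid x+i\in L\}$; a family $\mathcal{L}$ of subsets of $\mathbb{N}$ is closed under decrement if $L\in\mathcal{L}$ implies $L-1\in\mathcal{L}$. It is closed under $f^{ -1}$ if $L\in\mathcal{L}$ implies $f^{ -1}(L)=\{x\in\mathbb{N}\mid f(x)\in L\}\in\mathcal{L}$. A subset of $\mathbb{N}$ is regular if it is recognized by a finite automaton in unary notation; equivalently, if it is the union of a finite set with finitely many arithmetic progressions $a+r\mathbb{N}$ ($a,r\in\mathbb{N}$, $r\geq1$). For $L\subseteq\mathbb{N}$, $\mathcal{L}(L)$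 denotes the smallest lattice of subsets of $\mathbb{N}$ containing $L$ as a member and closed under decrement; equivalently, the family of all sets of the form $\bigcup_{j\in J}\bigcap_{i\in I_j}(L-i)$ where $J$ and the $I_j$'s are finite non empty subsets of $\mathbb{N}$. -}

module Defs where

open import Data.Fin.Base using (Fin)
open import Data.Fin.Subset as Fin using (Subset)
open import Data.Integer.Base as ℤ using (+_)
open import Data.Integer.Divisibility as ℤ using ()
open import Data.List.Base using (List)
open import Data.List.Membership.Propositional as List using ()
open import Data.Nat.Base using (ℕ; _+_; _*_; _≤_; _<_)
open import Data.Nat.GeneralisedArithmetic using (fold)
open import Data.Product.Base using (_×_; _,_; ∃; ∃-syntax)
open import Level using (Level; 0ℓ; suc; _⊔_)
open import Relation.Binary.Core using (_Preserves_⟶_)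
open import Relation.Binary.Definitions using (_Respects_)
open import Relation.Binary.PropositionalEquality.Core using (_≡_)
open import Relation.Unary
  using (Pred; _∈_; _⊆_; _≐_; _∪_; _∩_; _⊢_; Satisfiable)

private
  variable
    ℓ : Level

ℙℕ : Set₁
ℙℕ = Pred ℕ 0ℓ

Family : (ℓ : Level) → Set (suc 0ℓ ⊔ suc ℓ)
Family ℓ = Pred ℙℕ ℓ

-- Subsets are predicates, so their equality is _≐_ (mutual inclusion)
-- rather than _≡_; a family of subsets has to respect it.
record IsLattice (ℱ : Family ℓ) : Set (suc 0ℓ ⊔ ℓ) where
  field
    respects-≐ : ℱ Respects _≐_
    nonEmpty   : Satisfiable ℱ
    ∪-closed   : ∀ {A B} → A ∈ ℱ → B ∈ ℱ → A ∪ B ∈ ℱ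
    ∩-closed   : ∀ {A B} → A ∈ ℱ → B ∈ ℱ → A ∩ B ∈ ℱ

infixl 6 _-_

_-_ : ℙℕ → ℕ → ℙℕ
(L - i) x = x + i ∈ L

ClosedUnderDecrement : Family ℓ → Set (suc 0ℓ ⊔ ℓ)
ClosedUnderDecrement ℱ = ∀ {L} → L ∈ ℱ → L - 1 ∈ ℱ

-- f ⊢ L is the preimage f⁻¹(L) = { x ∣ f x ∈ L }.
ClosedUnderPreimage : (ℕ → ℕ) → Family ℓ → Set (suc 0ℓ ⊔ ℓ)
ClosedUnderPreimage f ℱ = ∀ {L} → L ∈ ℱ → f ⊢ L ∈ ℱ

-- Deterministic finite automata over a one-letter alphabet: the word of
-- length n, which is n in unary notation, leads from the start state to the
-- state obtained by applying the transition function n times.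
record UnaryDFA : Set where
  field
    #states   : ℕ
    start     : Fin #states
    next      : Fin #states → Fin #states
    accepting : Subset #states

  language : ℙℕ
  language n = fold start next n Fin.∈ accepting

Regular : ℙℕ → Set
Regular L = ∃[ M ] L ≐ UnaryDFA.language M

Finite : ℙℕ → Set
Finite L = ∃ λ (xs : List ℕ) → L ≐ (List._∈ xs)

progression : ℕ → ℕ → ℙℕ
progression q r x = ∃[ k ] x ≡ q + r * k

-- ℒ L is the smallest lattice containing L and closed under decrement,
-- generated inductively; ℒ-least is its minimality among such lattices.
data ℒ (L : ℙℕ) : Family (suc 0ℓ) where
  base : L ∈ ℒ L
  decr : ∀ {A} → A ∈ ℒ L → A - 1 ∈ ℒ L
  join : ∀ {A B} → A ∈ ℒ L → B ∈ ℒ L → A ∪ B ∈ ℒ L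
  meet : ∀ {A B} → A ∈ ℒ L → B ∈ ℒ L → A ∩ B ∈ ℒ L
  resp : ∀ {A B} → A ≐ B → A ∈ ℒ L → B ∈ ℒ L

ℒ-isLattice : ∀ L → IsLattice (ℒ L)
ℒ-isLattice L = record
  { respects-≐ = resp
  ; nonEmpty   = L , base
  ; ∪-closed   = join
  ; ∩-closed   = meet
  }

ℒ-closedUnderDecrement : ∀ L → ClosedUnderDecrement (ℒ L)
ℒ-closedUnderDecrement L = decr

ℒ-least : ∀ {L} {ℱ : Family ℓ} → IsLattice ℱ → ClosedUnderDecrement ℱ →
          L ∈ ℱ → ℒ L ⊆ ℱ
ℒ-least {L = L} {ℱ} lat dec L∈ℱ = go
  where
  open IsLattice lat
  go : ℒ L ⊆ ℱ
  go base         = L∈ℱ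
  go (decr a)     = dec (go a)
  go (join a b)   = ∪-closed (go a) (go b)
  go (meet a b)   = ∩-closed (go a) (go b)
  go (resp A≐B a) = respects-≐ A≐B (go a)

-- The families range over the level of ℒ L. This loses no generality: by
-- ℒ-least, a member L of a family ℱ at any level has ℒ L ⊆ ℱ, so closure
-- of ℒ L under preimage gives f ⊢ L ∈ ℱ.
RegularLatticesClosed : (ℕ → ℕ) → Set₂
RegularLatticesClosed f =
  (ℱ : Family (suc 0ℓ)) → IsLattice ℱ → ℱ ⊆ Regular →
  ClosedUnderDecrement ℱ → ClosedUnderPreimage f ℱ

FiniteLatticesClosed : (ℕ → ℕ) → Set₁
FiniteLatticesClosed f =
  (L : ℙℕ) → Finite L → ClosedUnderPreimage f (ℒ L)

ProgressionLatticesClosed : (ℕ → ℕ) → Set₁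
ProgressionLatticesClosed f =
  (q r : ℕ) → 0 < r → ClosedUnderPreimage f (ℒ (progression q r))

-- The congruence f a - f b ≡ 0 (mod a - b) is divisibility in ℤ; for a ≡ b
-- it reads 0 ∣ 0 and holds.
MonotoneInflationaryCongruent : (ℕ → ℕ) → Set
MonotoneInflationaryCongruent f =
  (f Preserves _≤_ ⟶ _≤_) ×
  (∀ a → a ≤ f a) ×
  (∀ a b → (+ a ℤ.- + b) ℤ.∣ (+ f a ℤ.- + f b))

{-# OPTIONS --safe #-}

-- (ii) ⇒ (iv) and (iii) ⇒ (iv): implications "x ∈ A → y ∈ A" that hold for A = L
-- and are stable under translation hold for all A in ℒ(L); so do upper bounds of A
-- and inclusions [q,∞) ⊆ A.  Testing f⁻¹(L) for
-- L = { x ≤ n ∣ x ≡ n mod r } or L = q + rℕ then yields f(a) ≥ a and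
-- f(a+d) ∈ f(a) + dℕ, which is (iv).
--
-- (iv) ⇒ everything else: if L − a ⊆ L − b then f(a) ∈ L implies f(b) ∈ L, because f(b)
-- is reached from f(a) by steps of length ∣a − b∣ that are translates of steps from
-- a + ℕ to b + ℕ.  Hence f⁻¹(L) = ⋃_{f(a) ∈ L} ⋂_{a+t ∈ L} (L − t), and both a and t may
-- be bounded when L is ultimately periodic.

module Submission where

open import Defs
open import Data.Fin.Base using (Fin; toℕ; fromℕ<)
open import Data.Fin.Properties using (pigeonhole; toℕ-fromℕ<; toℕ-injective)
import Data.Fin.Subset as Fin
open import Data.Fin.Subset.Properties using (_∈?_)
open import Data.Integer.Base as ℤ using (∣_∣)
import Data.Integer.Divisibility as ℤ
open import Data.Integer.Properties using (∣i-j∣≡∣j-i∣; m-n≡m⊖n; ∣⊖∣-≤)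
open import Data.List.Base using (upTo; filter)
open import Data.List.Extrema.Nat using (max; xs≤max)
open import Data.List.Membership.Propositional.Properties
  using (∈-filter⁺; ∈-filter⁻; ∈-upTo⁺)
import Data.List.Membership.DecPropositional as DecPropositional
open import Data.List.Relation.Unary.All using (lookup)
open import Data.Nat.Base
  using (ℕ; zero; suc; _+_; _*_; _∸_; _≤_; _<_; _⊓_; z≤n; s≤s; NonZero; >-nonZero; >-nonZero⁻¹)
open import Data.Nat.Divisibility using (_∣_; _∣?_; divides)
open import Data.Nat.DivMod using (_%_; _/_; m≡m%n+[m/n]*n; m%n<n)
open import Data.Nat.GeneralisedArithmetic using (fold; fold-+)
open import Data.Nat.Properties
open import Data.Nat.Tactic.RingSolver using (solve-∀)
open import Data.Product.Base using (_×_; _,_; proj₁; proj₂; ∃-syntax)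
open import Data.Sum.Base using (_⊎_; inj₁; inj₂)
open import Data.Unit.Base using (⊤; tt)
import Data.Vec.Base as Vec
open import Data.Vec.Properties using ([]=⇒lookup; lookup⇒[]=; lookup∘tabulate)
open import Function.Base using (_∘_; _$_)
open import Function.Bundles using (_⇔_; mk⇔; Equivalence)
open import Level using (Level)
open import Relation.Binary.Core using (Rel)
open import Relation.Binary.Definitions using (_Respects_)
open import Relation.Binary.PropositionalEquality
  using (_≡_; refl; sym; trans; cong; subst; module ≡-Reasoning)
open import Relation.Nullary using (yes; no; does; contradiction)
open import Relation.Nullary.Decidable using (_×-dec_; _⊎-dec_; dec-true; map′)
open import Relation.Unary using (Decidable; _∈_; _⊆_; _≐_; _∪_; _∩_; _⊢_)

private
  variable
    ℓ : Level
    A L : ℙℕ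
    n p q r : ℕ

BoundedBy : ℕ → ℙℕ → Set
BoundedBy n A = ∀ {x} → x ∈ A → x ≤ n

Periodic : ℕ → ℕ → ℙℕ → Set
Periodic N p A = ∀ {x} → N ≤ x → (x ∈ A) ⇔ (x + p ∈ A)

-- Invariants of ℒ L

-- Decrement tests membership one place further on, which `shift` absorbs; an implication valid in
-- both operands survives union and intersection. `R` may be one-way, so steps up and steps down can
-- be tested separately.
ℒ-respects : (R : Rel ℕ ℓ) → (∀ {x y} → R x y → R (x + 1) (y + 1)) →
             L Respects R → A ∈ ℒ L → A Respects R
ℒ-respects R shift L-resp = go
  where
  go : A ∈ ℒ _ → A Respects R
  go base         Rxy x∈A        = L-resp Rxy x∈A
  go (decr a)     Rxy x∈A        = go a (shift Rxy) x∈A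
  go (join a b)   Rxy (inj₁ x∈A) = inj₁ (go a Rxy x∈A)
  go (join a b)   Rxy (inj₂ x∈B) = inj₂ (go b Rxy x∈B)
  go (meet a b)   Rxy (x∈A , x∈B) = go a Rxy x∈A , go b Rxy x∈B
  go (resp A≐B a) Rxy x∈B        = proj₁ A≐B (go a Rxy (proj₂ A≐B x∈B))

ℒ-bounded : BoundedBy n L → A ∈ ℒ L → BoundedBy n A
ℒ-bounded L≤n base         x∈A         = L≤n x∈A
ℒ-bounded L≤n (decr a)     x∈A         = ≤-trans (m≤m+n _ 1) (ℒ-bounded L≤n a x∈A)
ℒ-bounded L≤n (join a b)   (inj₁ x∈A)  = ℒ-bounded L≤n a x∈A
ℒ-bounded L≤n (join a b)   (inj₂ x∈B)  = ℒ-bounded L≤n b x∈B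
ℒ-bounded L≤n (meet a b)   (x∈A , x∈B) = ℒ-bounded L≤n a x∈A
ℒ-bounded L≤n (resp A≐B a) x∈B         = ℒ-bounded L≤n a (proj₂ A≐B x∈B)

ℒ-⊇≥ : (q ≤_) ⊆ L → A ∈ ℒ L → (q ≤_) ⊆ A
ℒ-⊇≥ q≤⊆L base         q≤x = q≤⊆L q≤x
ℒ-⊇≥ q≤⊆L (decr a)     q≤x = ℒ-⊇≥ q≤⊆L a (≤-trans q≤x (m≤m+n _ 1))
ℒ-⊇≥ q≤⊆L (join a b)   q≤x = inj₁ (ℒ-⊇≥ q≤⊆L a q≤x)
ℒ-⊇≥ q≤⊆L (meet a b)   q≤x = ℒ-⊇≥ q≤⊆L a q≤x , ℒ-⊇≥ q≤⊆L b q≤x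
ℒ-⊇≥ q≤⊆L (resp A≐B a) q≤x = proj₁ A≐B (ℒ-⊇≥ q≤⊆L a q≤x)

decidable-resp-≐ : ∀ {A B : ℙℕ} → A ≐ B → Decidable A → Decidable B
decidable-resp-≐ (A⊆B , B⊆A) A? x = map′ A⊆B B⊆A (A? x)

ℒ-decidable : Decidable L → A ∈ ℒ L → Decidable A
ℒ-decidable L? base         x = L? x
ℒ-decidable L? (decr a)     x = ℒ-decidable L? a (x + 1)
ℒ-decidable L? (join a b)   x = ℒ-decidable L? a x ⊎-dec ℒ-decidable L? b x
ℒ-decidable L? (meet a b)   x = ℒ-decidable L? a x ×-dec ℒ-decidable L? b x
ℒ-decidable L? (resp A≐B a) x = decidable-resp-≐ A≐B (ℒ-decidable L? a) x

-- Finite sets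

finite⇒decidable : Finite L → Decidable L
finite⇒decidable (xs , L⊆xs , xs⊆L) x = map′ xs⊆L L⊆xs (x ∈ˡ? xs)
  where open DecPropositional _≟_ using () renaming (_∈?_ to _∈ˡ?_)

finite⇒bounded : Finite L → ∃[ n ] BoundedBy n L
finite⇒bounded (xs , L⊆xs , _) = max 0 xs , λ x∈L → lookup (xs≤max 0 xs) (L⊆xs x∈L)

decidable∧bounded⇒finite : Decidable L → BoundedBy n L → Finite L
decidable∧bounded⇒finite {n = n} L? L≤n =
  filter L? (upTo (suc n)) ,
  (λ x∈L → ∈-filter⁺ L? (∈-upTo⁺ (s≤s (L≤n x∈L))) x∈L) ,
  (λ x∈xs → proj₂ (∈-filter⁻ L? {xs = upTo (suc n)} x∈xs))

-- The automaton counts up to n + 1 and then stays there.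
decidable∧bounded⇒regular : Decidable A → BoundedBy n A → Regular A
decidable∧bounded⇒regular {A = A} {n = n} A? A≤n = M , A⊆M , M⊆A
  where
  state : ℕ → Fin (suc (suc n))
  state x = fromℕ< (s≤s (m⊓n≤n x (suc n)))

  toℕ-state : ∀ x → toℕ (state x) ≡ x ⊓ suc n
  toℕ-state x = toℕ-fromℕ< _

  accepted = does ∘ A? ∘ toℕ

  M : UnaryDFA
  M = record
    { #states   = suc (suc n)
    ; start     = state 0
    ; next      = state ∘ suc ∘ toℕ
    ; accepting = Vec.tabulate accepted
    }
  open UnaryDFA M using (start; next; accepting)

  suc-⊓ : ∀ x m → suc (x ⊓ m) ⊓ m ≡ suc x ⊓ m
  suc-⊓ x m with ≤-total x m
  ... | inj₁ x≤m = cong (λ z → suc z ⊓ m) (m≤n⇒m⊓n≡m x≤m)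
  ... | inj₂ m≤x = begin
    suc (x ⊓ m) ⊓ m ≡⟨ cong (λ z → suc z ⊓ m) (m≥n⇒m⊓n≡n m≤x) ⟩
    suc m ⊓ m       ≡⟨ m≥n⇒m⊓n≡n (n≤1+n m) ⟩
    m               ≡⟨ m≥n⇒m⊓n≡n (m≤n⇒m≤1+n m≤x) ⟨
    suc x ⊓ m       ∎
    where open ≡-Reasoning

  run : ∀ x → fold start next x ≡ state x
  run zero    = refl
  run (suc x) = trans (cong next (run x)) $ toℕ-injective $ begin
    toℕ (state (suc (toℕ (state x)))) ≡⟨ toℕ-state _ ⟩
    suc (toℕ (state x)) ⊓ suc n       ≡⟨ cong (λ z → suc z ⊓ suc n) (toℕ-state x) ⟩
    suc (x ⊓ suc n) ⊓ suc n           ≡⟨ suc-⊓ x (suc n) ⟩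
    suc x ⊓ suc n                     ≡⟨ toℕ-state (suc x) ⟨
    toℕ (state (suc x))               ∎
    where open ≡-Reasoning

  accepts : ∀ {s} → toℕ s ∈ A → s Fin.∈ accepting
  accepts {s} s∈A = lookup⇒[]= s _ (trans (lookup∘tabulate accepted s) (dec-true (A? (toℕ s)) s∈A))

  accepts⁻ : ∀ {s} → s Fin.∈ accepting → toℕ s ∈ A
  accepts⁻ {s} s∈acc with A? (toℕ s) | trans (sym (lookup∘tabulate accepted s)) ([]=⇒lookup s∈acc)
  ... | yes s∈A | _  = s∈A
  ... | no  _   | ()

  A⊆M : A ⊆ UnaryDFA.language M
  A⊆M {x} x∈A rewrite run x =
    accepts (subst A (sym (trans (toℕ-state x) (m≤n⇒m⊓n≡m (m≤n⇒m≤1+n (A≤n x∈A))))) x∈A)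

  M⊆A : UnaryDFA.language M ⊆ A
  M⊆A {x} x∈M with ≤-total x (suc n)
                | subst A (toℕ-state x) (accepts⁻ (subst (Fin._∈ accepting) (run x) x∈M))
  ... | inj₁ x≤1+n | ∈A = subst A (m≤n⇒m⊓n≡m x≤1+n) ∈A
  -- Every x beyond n ends in state n + 1, which is rejecting because it exceeds the bound; hence n
  -- + 2 states.
  ... | inj₂ 1+n≤x | ∈A =
    contradiction (A≤n (subst A (m≥n⇒m⊓n≡n 1+n≤x) ∈A)) 1+n≰n

-- Regular sets

regular⇒decidable : Regular L → Decidable L
regular⇒decidable (M , L⊆M , M⊆L) x = map′ M⊆L L⊆M (_ ∈? UnaryDFA.accepting M)

-- Among the states at times 0 to `#states` two coincide, say at i < j; from time i on the run
-- repeats with period j - i.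
regular⇒periodic : Regular L → ∃[ N ] ∃[ p ] 0 < p × Periodic N p L
regular⇒periodic {L = L} (M , L⊆M , M⊆L) with pigeonhole (n<1+n #states) (λ i → run (toℕ i))
  where
  open UnaryDFA M
  run : ℕ → Fin #states
  run = fold start next
... | i , j , i<j , runᵢ≡runⱼ = toℕ i , toℕ j ∸ toℕ i , m<n⇒0<n∸m i<j , periodic
  where
  open UnaryDFA M
  d = toℕ j ∸ toℕ i

  run-+d : ∀ {x} → toℕ i ≤ x → fold start next x ≡ fold start next (x + d)
  run-+d {x} i≤x = begin
    run x                  ≡⟨ cong run (m∸n+n≡m i≤x) ⟨
    run (u + toℕ i)        ≡⟨ fold-+ start next u ⟩
    fold (run (toℕ i)) next u ≡⟨ cong (λ s → fold s next u) runᵢ≡runⱼ ⟩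
    fold (run (toℕ j)) next u ≡⟨ fold-+ start next u ⟨
    run (u + toℕ j)        ≡⟨ cong (λ m → run (u + m)) (m+[n∸m]≡n (<⇒≤ i<j)) ⟨
    run (u + (toℕ i + d))  ≡⟨ cong run (+-assoc u (toℕ i) d) ⟨
    run (u + toℕ i + d)    ≡⟨ cong (λ m → run (m + d)) (m∸n+n≡m i≤x) ⟩
    run (x + d)            ∎
    where
    open ≡-Reasoning
    u = x ∸ toℕ i
    run = fold start next

  periodic : Periodic (toℕ i) d L
  periodic i≤x = mk⇔
    (M⊆L ∘ subst (Fin._∈ accepting) (run-+d i≤x) ∘ L⊆M)
    (M⊆L ∘ subst (Fin._∈ accepting) (sym (run-+d i≤x)) ∘ L⊆M)

-- Lattices closed under decrement

-- A is an extra operand that rules out empty intersections and unions: a lattice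
-- need contain neither ℕ nor ∅.
⋂ : ℙℕ → ℙℕ → (ℕ → ℙℕ) → ℕ → ℙℕ
⋂ A P B n x = x ∈ A × (∀ {i} → i < n → i ∈ P → x ∈ B i)

⋃ : ℙℕ → ℙℕ → (ℕ → ℙℕ) → ℕ → ℙℕ
⋃ A P B n x = x ∈ A ⊎ ∃[ i ] i < n × i ∈ P × x ∈ B i

module DecrementLattice {ℱ : Family ℓ} (lattice : IsLattice ℱ)
                        (ℱ-decr : ClosedUnderDecrement ℱ) where
  open IsLattice lattice

  ∸-closed : ∀ i → L ∈ ℱ → L - i ∈ ℱ
  ∸-closed {L = L} zero L∈ℱ = respects-≐
    ((λ {x} → subst L (sym (+-identityʳ x))) , (λ {x} → subst L (+-identityʳ x))) L∈ℱ
  ∸-closed {L = L} (suc i) L∈ℱ = respects-≐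
    ((λ {x} → subst L (+-assoc x 1 i)) , (λ {x} → subst L (sym (+-assoc x 1 i))))
    (ℱ-decr (∸-closed i L∈ℱ))

  -- Induction on n: deciding `P` at the last index tells whether its set must be intersected in or
  -- nothing changes.
  ⋂-closed : {P : ℙℕ} {B : ℕ → ℙℕ} → Decidable P → (∀ i → B i ∈ ℱ) → A ∈ ℱ →
             ∀ n → ⋂ A P B n ∈ ℱ
  ⋂-closed P? B∈ℱ A∈ℱ zero = respects-≐ ((λ x∈A → x∈A , λ ()) , proj₁) A∈ℱ
  ⋂-closed {A = A} {P} {B} P? B∈ℱ A∈ℱ (suc n) with ⋂-closed P? B∈ℱ A∈ℱ n | P? n
  ... | rest | yes n∈P = respects-≐ (to , from) (∩-closed rest (B∈ℱ n))
    where
    to : ⋂ A P B n ∩ B n ⊆ ⋂ A P B (suc n)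
    to {x} ((x∈A , x∈) , x∈Bn) = x∈A , x∈⁺
      where
      x∈⁺ : ∀ {i} → i < suc n → i ∈ P → x ∈ B i
      x∈⁺ i<1+n i∈P with m<1+n⇒m<n∨m≡n i<1+n
      ... | inj₁ i<n  = x∈ i<n i∈P
      ... | inj₂ refl = x∈Bn
    from : ⋂ A P B (suc n) ⊆ ⋂ A P B n ∩ B n
    from (x∈A , x∈) = (x∈A , x∈ ∘ m<n⇒m<1+n) , x∈ ≤-refl n∈P
  ... | rest | no n∉P = respects-≐ (to , from) rest
    where
    to : ⋂ A P B n ⊆ ⋂ A P B (suc n)
    to {x} (x∈A , x∈) = x∈A , x∈⁺
      where
      x∈⁺ : ∀ {i} → i < suc n → i ∈ P → x ∈ B i
      x∈⁺ i<1+n i∈P with m<1+n⇒m<n∨m≡n i<1+n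
      ... | inj₁ i<n  = x∈ i<n i∈P
      ... | inj₂ refl = contradiction i∈P n∉P
    from : ⋂ A P B (suc n) ⊆ ⋂ A P B n
    from (x∈A , x∈) = x∈A , x∈ ∘ m<n⇒m<1+n

  ⋃-closed : {P : ℙℕ} {B : ℕ → ℙℕ} → Decidable P → (∀ i → B i ∈ ℱ) → A ∈ ℱ →
             ∀ n → ⋃ A P B n ∈ ℱ
  ⋃-closed P? B∈ℱ A∈ℱ zero = respects-≐ (inj₁ , λ { (inj₁ x∈A) → x∈A ; (inj₂ (_ , () , _)) }) A∈ℱ
  ⋃-closed {A = A} {P} {B} P? B∈ℱ A∈ℱ (suc n) with ⋃-closed P? B∈ℱ A∈ℱ n | P? n
  ... | rest | yes n∈P = respects-≐ (to , from) (∪-closed rest (B∈ℱ n))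
    where
    to : ⋃ A P B n ∪ B n ⊆ ⋃ A P B (suc n)
    to (inj₁ (inj₁ x∈A))                   = inj₁ x∈A
    to (inj₁ (inj₂ (i , i<n , i∈P , x∈B))) = inj₂ (i , m<n⇒m<1+n i<n , i∈P , x∈B)
    to (inj₂ x∈Bn)                         = inj₂ (n , ≤-refl , n∈P , x∈Bn)
    from : ⋃ A P B (suc n) ⊆ ⋃ A P B n ∪ B n
    from (inj₁ x∈A) = inj₁ (inj₁ x∈A)
    from (inj₂ (i , i<1+n , i∈P , x∈B)) with m<1+n⇒m<n∨m≡n i<1+n
    ... | inj₁ i<n  = inj₁ (inj₂ (i , i<n , i∈P , x∈B))
    ... | inj₂ refl = inj₂ x∈B
  ... | rest | no n∉P = respects-≐ (to , from) rest
    where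
    to : ⋃ A P B n ⊆ ⋃ A P B (suc n)
    to (inj₁ x∈A)                   = inj₁ x∈A
    to (inj₂ (i , i<n , i∈P , x∈B)) = inj₂ (i , m<n⇒m<1+n i<n , i∈P , x∈B)
    from : ⋃ A P B (suc n) ⊆ ⋃ A P B n
    from (inj₁ x∈A) = inj₁ x∈A
    from (inj₂ (i , i<1+n , i∈P , x∈B)) with m<1+n⇒m<n∨m≡n i<1+n
    ... | inj₁ i<n  = inj₂ (i , i<n , i∈P , x∈B)
    ... | inj₂ refl = contradiction i∈P n∉P

-- Condition (iv) without subtraction

Inflationary : (ℕ → ℕ) → Set
Inflationary f = ∀ a → a ≤ f a

-- Monotonicity and congruence in one: a natural k makes the increment nonnegative, and the factor d
-- is the congruence.
MultipleIncrements : (ℕ → ℕ) → Set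
MultipleIncrements f = ∀ a d → ∃[ k ] f (a + d) ≡ f a + k * d

∣+[m+n]-+m∣≡n : ∀ m n → ∣ ℤ.+ (m + n) ℤ.- ℤ.+ m ∣ ≡ n
∣+[m+n]-+m∣≡n m n = begin
  ∣ ℤ.+ (m + n) ℤ.- ℤ.+ m ∣ ≡⟨ ∣i-j∣≡∣j-i∣ (ℤ.+ (m + n)) (ℤ.+ m) ⟩
  ∣ ℤ.+ m ℤ.- ℤ.+ (m + n) ∣ ≡⟨ cong ∣_∣ (m-n≡m⊖n m (m + n)) ⟩
  ∣ m ℤ.⊖ (m + n) ∣     ≡⟨ ∣⊖∣-≤ (m≤m+n m n) ⟩
  m + n ∸ m             ≡⟨ m+n∸m≡n m n ⟩
  n                     ∎
  where open ≡-Reasoning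

module _ {f : ℕ → ℕ} where

  congruent⇒multipleIncrements : MonotoneInflationaryCongruent f → MultipleIncrements f
  congruent⇒multipleIncrements (mono , _ , cong-f) a d
    -- Monotonicity writes f (a + d) as f a + e, so the two integer differences reduce to the
    -- naturals d and e.
    with m≤n⇒∃[o]m+o≡n (mono (m≤m+n a d)) | cong-f (a + d) a
  ... | e , fa+e≡f[a+d] | a+d-a∣
    rewrite sym fa+e≡f[a+d] | ∣+[m+n]-+m∣≡n a d | ∣+[m+n]-+m∣≡n (f a) e
    with a+d-a∣
  ... | divides k e≡k*d = k , cong (f a +_) e≡k*d

  multipleIncrements⇒congruent : Inflationary f → MultipleIncrements f → MonotoneInflationaryCongruent f
  multipleIncrements⇒congruent infl incr = mono , infl , cong-f
    where
    mono : ∀ {a b} → a ≤ b → f a ≤ f b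
    mono {a} a≤b with m≤n⇒∃[o]m+o≡n a≤b
    ... | d , refl with incr a d
    ...   | k , eq rewrite eq = m≤m+n (f a) (k * d)

    ∣-up : ∀ a d → (ℤ.+ (a + d) ℤ.- ℤ.+ a) ℤ.∣ (ℤ.+ f (a + d) ℤ.- ℤ.+ f a)
    ∣-up a d with incr a d
    ... | k , eq rewrite eq | ∣+[m+n]-+m∣≡n a d | ∣+[m+n]-+m∣≡n (f a) (k * d) = divides k refl

    cong-f : ∀ a b → (ℤ.+ a ℤ.- ℤ.+ b) ℤ.∣ (ℤ.+ f a ℤ.- ℤ.+ f b)
    cong-f a b with ≤-total a b
    ... | inj₂ b≤a with m≤n⇒∃[o]m+o≡n b≤a
    ...   | d , refl = ∣-up b d
    cong-f a b | inj₁ a≤b with m≤n⇒∃[o]m+o≡n a≤b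
    ...   | d , refl
      -- Integer divisibility sees only absolute values, so both differences may be reversed.
      rewrite ∣i-j∣≡∣j-i∣ (ℤ.+ a) (ℤ.+ (a + d)) | ∣i-j∣≡∣j-i∣ (ℤ.+ f a) (ℤ.+ f (a + d))
      = ∣-up a d

-- (iv) implies closure under f⁻¹

module _ {f : ℕ → ℕ} (infl : Inflationary f) (incr : MultipleIncrements f) where

  private
    -- A step ends at a + d + u = a + (u + d), where the hypothesis applies again.
    chain-up : ∀ {a d} → (∀ u → a + u ∈ L → a + d + u ∈ L) →
               ∀ k u → a + u ∈ L → a + u + k * d ∈ L
    chain-up {L = L} step zero u ∈L = subst L (sym (+-identityʳ _)) ∈L
    chain-up {L = L} {a} {d} step (suc k) u ∈L =
      subst L (eq₂ a u d (k * d)) (chain-up {L = L} step k (u + d) (subst L (eq₁ a d u) (step u ∈L)))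
      where
      eq₁ : ∀ a d u → a + d + u ≡ a + (u + d)
      eq₁ = solve-∀
      eq₂ : ∀ a u d e → a + (u + d) + e ≡ a + u + (d + e)
      eq₂ = solve-∀

    -- The topmost step is undone first, by the hypothesis at u + k * d.
    chain-down : ∀ {a d} → (∀ u → a + d + u ∈ L → a + u ∈ L) →
                 ∀ k u → a + u + k * d ∈ L → a + u ∈ L
    chain-down {L = L} step zero u ∈L = subst L (+-identityʳ _) ∈L
    chain-down {L = L} {a} {d} step (suc k) u ∈L =
      chain-down {L = L} step k u
        (subst L (sym (+-assoc a u (k * d))) (step (u + k * d) (subst L (eq a u d (k * d)) ∈L)))
      where
      eq : ∀ a u d e → a + u + (d + e) ≡ a + d + (u + e)
      eq = solve-∀

  -- Inflation puts f a and f b above the smaller of a and b, so every step between them is a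
  -- translate covered by the hypothesis: upward if a ≤ b, downward otherwise.
  preimage-transfer : ∀ a b → (∀ t → a + t ∈ L → b + t ∈ L) → f a ∈ L → f b ∈ L
  preimage-transfer {L = L} a b sub fa∈L with ≤-total a b
  ... | inj₁ a≤b with m≤n⇒∃[o]m+o≡n a≤b
  ...   | d , refl with incr a d | m≤n⇒∃[o]m+o≡n (infl a)
  ...     | k , eq | s , a+s≡fa rewrite eq | sym a+s≡fa = chain-up {L = L} sub k s fa∈L
  preimage-transfer {L = L} a b sub fa∈L | inj₂ b≤a with m≤n⇒∃[o]m+o≡n b≤a
  ...   | d , refl with incr b d | m≤n⇒∃[o]m+o≡n (infl b)
  ...     | k , eq | s , b+s≡fb rewrite eq | sym b+s≡fb = chain-down {L = L} sub k s fa∈L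

  module _ (N p : ℕ) where

    infix 4 _~_
    -- Congruence modulo p beyond N, oriented from the smaller element so that one bound suffices.
    -- It replaces arbitrary indices by indices below N + p.
    _~_ : Rel ℕ _
    y ~ x = y ≡ x ⊎ (N ≤ y × ∃[ m ] x ≡ y + m * p)

    ~-+ : ∀ {y x} t → y ~ x → y + t ~ x + t
    ~-+ t (inj₁ refl) = inj₁ refl
    ~-+ {y} t (inj₂ (N≤y , m , refl)) =
      inj₂ (≤-trans N≤y (m≤m+n y t) , m , eq y (m * p) t)
      where
      eq : ∀ y e t → y + e + t ≡ y + t + e
      eq = solve-∀

    -- A jump by m * p becomes a jump by (k * m) * p, and inflation keeps f y beyond N.
    ~-f : ∀ {y x} → y ~ x → f y ~ f x
    ~-f (inj₁ refl) = inj₁ refl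
    ~-f {y} (inj₂ (N≤y , m , refl)) with incr y (m * p)
    ... | k , eq = inj₂ (≤-trans N≤y (infl y) , k * m ,
      trans eq (cong (f y +_) (sym (*-assoc k m p))))

    ~-representative : .{{_ : NonZero p}} → ∀ x → ∃[ y ] y < N + p × y ~ x
    ~-representative x with ≤-total N x
    ... | inj₂ x≤N = x , ≤-<-trans x≤N (m<m+n N (>-nonZero⁻¹ p)) , inj₁ refl
    ... | inj₁ N≤x with m≤n⇒∃[o]m+o≡n N≤x
    ...   | z , refl = N + z % p , +-monoʳ-< N (m%n<n z p) ,
      inj₂ (m≤m+n N _ , z / p ,
            trans (cong (N +_) (m≡m%n+[m/n]*n z p)) (sym (+-assoc N (z % p) (z / p * p))))

    ~-resp : Periodic N p L → ∀ {y x} → y ~ x → (y ∈ L) ⇔ (x ∈ L)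
    ~-resp per (inj₁ refl) = mk⇔ (λ z → z) (λ z → z)
    ~-resp {L = L} per {y} (inj₂ (N≤y , m , refl)) = mk⇔ (up m) (down m)
      where
      eq : ∀ m → y + m * p + p ≡ y + suc m * p
      eq m = trans (+-assoc y (m * p) p) (cong (y +_) (+-comm (m * p) p))
      up : ∀ m → y ∈ L → y + m * p ∈ L
      up zero    ∈L = subst L (sym (+-identityʳ y)) ∈L
      up (suc m) ∈L = subst L (eq m)
        (Equivalence.to (per (≤-trans N≤y (m≤m+n y (m * p)))) (up m ∈L))
      down : ∀ m → y + m * p ∈ L → y ∈ L
      down zero    ∈L = subst L (+-identityʳ y) ∈L
      down (suc m) ∈L = down m
        (Equivalence.from (per (≤-trans N≤y (m≤m+n y (m * p)))) (subst L (sym (eq m)) ∈L))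

  -- Decidability of L selects the cells and the indices inside each; `~` cuts both ranges down to N
  -- + p.
  preimage-closed : {ℱ : Family ℓ} → IsLattice ℱ → ClosedUnderDecrement ℱ →
                    ∀ {N} → Decidable L → 0 < p → Periodic N p L → L ∈ ℱ → f ⊢ L ∈ ℱ
  preimage-closed {L = L} {p = p} {ℱ = ℱ} lattice ℱ-decr {N} L? 0<p per L∈ℱ =
    respects-≐ (U⊆f⊢L , f⊢L⊆U) U∈ℱ
    where
    open IsLattice lattice
    open DecrementLattice lattice ℱ-decr
    instance
      p≢0 : NonZero p
      p≢0 = >-nonZero 0<p

    M = N + p

    -- By periodicity Full = ⋂_{t ∈ ℕ} (L − t), which lies in f⁻¹(L); and if f a ∈ L then
    -- Cell a = ⋂_{a+t ∈ L} (L − t), where t = f a ∸ a is one of the indices.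
    Full : ℙℕ
    Full = ⋂ L (λ _ → ⊤) (L -_) M

    Cell : ℕ → ℙℕ
    Cell a = ⋂ (L - (f a ∸ a)) (λ t → a + t ∈ L) (L -_) M

    -- `Full` keeps the union nonempty when no a below M has f a in L.
    U : ℙℕ
    U = ⋃ Full (f ⊢ L) Cell M

    U∈ℱ : U ∈ ℱ
    U∈ℱ = ⋃-closed (L? ∘ f)
      (λ a → ⋂-closed (λ t → L? (a + t)) (λ t → ∸-closed t L∈ℱ) (∸-closed (f a ∸ a) L∈ℱ) M)
      (⋂-closed (λ _ → yes tt) (λ t → ∸-closed t L∈ℱ) L∈ℱ M) M

    L-resp : ∀ {y x} → _~_ N p y x → (y ∈ L) ⇔ (x ∈ L)
    L-resp = ~-resp N p {L = L} per

    ~-+ˡ : ∀ x {t′ t} → _~_ N p t′ t → _~_ N p (x + t′) (x + t)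
    ~-+ˡ x {t′} {t} t′~t rewrite +-comm x t′ | +-comm x t = ~-+ N p x t′~t

    U⊆f⊢L : U ⊆ f ⊢ L
    U⊆f⊢L {x} (inj₁ (_ , x∈)) with m≤n⇒∃[o]m+o≡n (infl x)
    -- Only t below M occur in `Full`; periodicity carries x + t′ ∈ L over to x + t = f x.
    ... | t , x+t≡fx with ~-representative N p t
    ...   | t′ , t′<M , t′~t =
      subst L x+t≡fx (Equivalence.to (L-resp (~-+ˡ x t′~t)) (x∈ t′<M tt))
    U⊆f⊢L {x} (inj₂ (a , _ , fa∈L , _ , x∈)) = preimage-transfer {L = L} a x sub fa∈L
      where
      sub : ∀ t → a + t ∈ L → x + t ∈ L
      sub t a+t∈L with ~-representative N p t
      -- From a + t down to a + t′, across by the cell to x + t′, then up to x + t.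
      ... | t′ , t′<M , t′~t = Equivalence.to (L-resp (~-+ˡ x t′~t))
        (x∈ t′<M (Equivalence.from (L-resp (~-+ˡ a t′~t)) a+t∈L))

    f⊢L⊆U : f ⊢ L ⊆ U
    f⊢L⊆U {x} fx∈L with ~-representative N p x
    -- x lies in the cell of its representative a, since translation by t preserves `~`.
    ... | a , a<M , a~x = inj₂ (a , a<M , fa∈L ,
        move (subst L (sym (m+[n∸m]≡n (infl a))) fa∈L) , λ _ → move)
      where
      fa∈L : f a ∈ L
      fa∈L = Equivalence.from (L-resp (~-f N p a~x)) fx∈L
      move : ∀ {t} → a + t ∈ L → x + t ∈ L
      move {t} = Equivalence.to (L-resp (~-+ N p t a~x))

-- Progressions

progression-decidable : ∀ q r → Decidable (progression q r)
progression-decidable q r x = map′ to from (q ≤? x ×-dec r ∣? (x ∸ q))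
  where
  to : q ≤ x × r ∣ (x ∸ q) → x ∈ progression q r
  to (q≤x , divides k eq) =
    k , trans (sym (m+[n∸m]≡n q≤x)) (cong (q +_) (trans eq (*-comm k r)))
  from : x ∈ progression q r → q ≤ x × r ∣ (x ∸ q)
  from (k , refl) = m≤m+n q _ , divides k (trans (m+n∸m≡n q (r * k)) (*-comm r k))

progression-step : ∀ {x} → x ∈ progression q r → x + r ∈ progression q r
progression-step {q} {r} (k , refl) = suc k , eq q r k
  where
  eq : ∀ q r k → q + r * k + r ≡ q + r * suc k
  eq = solve-∀

-- The bound q ≤ x matters at k = 0, where x + r = q: it leaves only x = q.
progression-unstep : ∀ {x} → q ≤ x → x + r ∈ progression q r → x ∈ progression q r
progression-unstep {q} {r} {x} q≤x (zero , eq) = 0 , trans x≡q (sym q+r*0≡q)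
  where
  q+r*0≡q : q + r * 0 ≡ q
  q+r*0≡q = trans (cong (q +_) (*-zeroʳ r)) (+-identityʳ q)
  x≡q : x ≡ q
  x≡q = ≤-antisym (≤-trans (m≤m+n x r) (≤-reflexive (trans eq q+r*0≡q))) q≤x
progression-unstep {q} {r} {x} q≤x (suc k , eq) =
  k , +-cancelʳ-≡ r x (q + r * k) (trans eq (eq′ q r k))
  where
  eq′ : ∀ q r k → q + r * suc k ≡ q + r * k + r
  eq′ = solve-∀

+-exchange : ∀ x r → x + r + 1 ≡ x + 1 + r
+-exchange = solve-∀

-- Stepping up by r is harmless everywhere; for stepping down the relation carries q ≤ x, which is
-- stable under shifting.
ℒ-progression-periodic : A ∈ ℒ (progression q r) → Periodic q r A
ℒ-progression-periodic {q = q} {r} A∈ℒ {x} q≤x = mk⇔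
  (ℒ-respects (λ x y → y ≡ x + r) (λ { {x} refl → +-exchange x r })
    (λ { refl → progression-step }) A∈ℒ refl)
  (ℒ-respects (λ y x → q ≤ x × y ≡ x + r)
    (λ { {y = x} (q≤x , refl) → ≤-trans q≤x (m≤m+n x 1) , +-exchange x r })
    (λ { (q≤x , refl) → progression-unstep q≤x }) A∈ℒ (q≤x , refl))

-- A finite mirror image of `progression`, descending from n in steps of r; r = 0 gives the
-- singleton of n.
coprogression : ℕ → ℕ → ℙℕ
coprogression n r x = ∃[ k ] n ≡ x + k * r

coprogression-decidable : ∀ n r → Decidable (coprogression n r)
coprogression-decidable n r x = map′ to from (x ≤? n ×-dec r ∣? (n ∸ x))
  where
  to : x ≤ n × r ∣ (n ∸ x) → x ∈ coprogression n r
  to (x≤n , divides k eq) = k , trans (sym (m+[n∸m]≡n x≤n)) (cong (x +_) eq)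
  from : x ∈ coprogression n r → x ≤ n × r ∣ (n ∸ x)
  from (k , refl) = m≤m+n x _ , divides k (m+n∸m≡n x (k * r))

coprogression-bounded : BoundedBy n (coprogression n r)
coprogression-bounded (k , refl) = m≤m+n _ _

coprogression-finite : ∀ n r → Finite (coprogression n r)
coprogression-finite n r =
  decidable∧bounded⇒finite (coprogression-decidable n r) coprogression-bounded

coprogression-step : ∀ {x} → x + r ∈ coprogression n r → x ∈ coprogression n r
coprogression-step {r} {n} {x} (k , eq) = suc k , trans eq (+-assoc x r (k * r))

-- The implications between (i), (ii), (iii) and (iv)

module _ {f : ℕ → ℕ} where

  -- Boundedness and decidability pass from L to all of `ℒ L`, so its members are regular.
  regular⇒finite : RegularLatticesClosed f → FiniteLatticesClosed f
  regular⇒finite closed L L-finite = closed (ℒ L) (ℒ-isLattice L) ℒ⊆Regular decr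
    where
    ℒ⊆Regular : ℒ L ⊆ Regular
    ℒ⊆Regular A∈ℒ = decidable∧bounded⇒regular
      (ℒ-decidable (finite⇒decidable L-finite) A∈ℒ)
      (ℒ-bounded (proj₂ (finite⇒bounded L-finite)) A∈ℒ)

  finite⇒congruent : FiniteLatticesClosed f → MonotoneInflationaryCongruent f
  finite⇒congruent closed = multipleIncrements⇒congruent infl incr
    where
    preimage∈ℒ : ∀ n r → f ⊢ coprogression n r ∈ ℒ (coprogression n r)
    preimage∈ℒ n r = closed _ (coprogression-finite n r) base

    infl : Inflationary f
    -- With L the singleton of f a, the preimage contains a and inherits the bound f a.
    infl a = ℒ-bounded coprogression-bounded (preimage∈ℒ (f a) 0) (0 , sym (+-identityʳ (f a)))

    incr : MultipleIncrements f
    -- The preimage contains a + d, hence also a, so f (a + d) is f a plus a multiple of d.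
    incr a d = ℒ-respects (λ x y → x ≡ y + d) (λ { {y = y} refl → +-exchange y d })
      (λ { refl → coprogression-step }) (preimage∈ℒ (f (a + d)) d) refl
      (0 , sym (+-identityʳ (f (a + d))))

  progression⇒congruent : ProgressionLatticesClosed f → MonotoneInflationaryCongruent f
  progression⇒congruent closed = multipleIncrements⇒congruent infl incr
    where
    infl : Inflationary f
    -- Here L is the ray from a; its preimage contains that ray, in particular a.
    infl a with ℒ-⊇≥ {q = a} a≤⊆L (closed a 1 (s≤s z≤n) base) ≤-refl
      where
      a≤⊆L : (a ≤_) ⊆ progression a 1
      a≤⊆L {x} a≤x =
        x ∸ a , sym (trans (cong (a +_) (*-identityˡ (x ∸ a))) (m+[n∸m]≡n a≤x))
    ... | k , eq = ≤-trans (m≤m+n a _) (≤-reflexive (sym eq))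

    incr : MultipleIncrements f
    incr a zero = 0 , trans (cong f (+-identityʳ a)) (sym (+-identityʳ (f a)))
    -- Steps of progressions are positive, hence the separate case d = 0. For L starting at f a with
    -- step d, the preimage contains a and so a + d.
    incr a d@(suc _) with ℒ-respects (λ x y → y ≡ x + d) (λ { {x} refl → +-exchange x d })
      (λ { refl → progression-step {q = f a} }) (closed (f a) d (s≤s z≤n) base) {x = a} refl
      (0 , sym (trans (cong (f a +_) (*-zeroʳ d)) (+-identityʳ (f a))))
    ... | k , eq = k , trans eq (cong (f a +_) (*-comm d k))

  congruent⇒regular : MonotoneInflationaryCongruent f → RegularLatticesClosed f
  congruent⇒regular iv@(_ , infl , _) ℱ lattice ℱ⊆Regular ℱ-decr L∈ℱ
    with regular⇒periodic (ℱ⊆Regular L∈ℱ)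
  ... | N , p , 0<p , per = preimage-closed infl (congruent⇒multipleIncrements iv) lattice ℱ-decr
    (regular⇒decidable (ℱ⊆Regular L∈ℱ)) 0<p per L∈ℱ

  -- Members of the lattice inherit threshold q and period r from the progression itself.
  congruent⇒progression : MonotoneInflationaryCongruent f → ProgressionLatticesClosed f
  congruent⇒progression iv@(_ , infl , _) q r 0<r A∈ℒ =
    preimage-closed infl (congruent⇒multipleIncrements iv) (ℒ-isLattice _) decr
      (ℒ-decidable (progression-decidable q r) A∈ℒ) 0<r (ℒ-progression-periodic A∈ℒ) A∈ℒ

theorem5p1 : (f : ℕ → ℕ) →
    (RegularLatticesClosed f ⇔ FiniteLatticesClosed f) ×
    (FiniteLatticesClosed f ⇔ ProgressionLatticesClosed f) ×
    (ProgressionLatticesClosed f ⇔ MonotoneInflationaryCongruent f)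
theorem5p1 f =
  -- Apart from (i) ⇒ (ii), every implication passes through (iv) or ends there.
  mk⇔ regular⇒finite (congruent⇒regular ∘ finite⇒congruent) ,
  mk⇔ (congruent⇒progression ∘ finite⇒congruent)
      (regular⇒finite ∘ congruent⇒regular ∘ progression⇒congruent) ,
  mk⇔ progression⇒congruent congruent⇒progression
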